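{- Let $k$ be an integer. If $k\not\equiv 2\pmod 4$ and $k\ge 3$, then the Möbius ladder $M_k$ is cordial.
   Context: Graphs are finite and may have multiple edges but not loops. A binary labeling of a graph $G$ is a function $f:V(G)\to\{0,1\}$. Two real numbers $x,y$ are roughly equal if $0\le |x-y|\le 1$. A binary labeling $f$ is friendly if $|f^{ -1}(0)|$ and $|f^{ -1}(1)|$ are roughly equal. A binary labeling $f$ induces an edge labeling $f_e:E(G)\to\{0,1\}$ by $f_e(uv)=f(u)+f(v)$ modulo 2. A friendly labeling $f$ of $G$ is cordial if $|f_e^{ -1}(0)|$ and $|f_e^{ -1}(1)|$ are roughly equal; a graph is cordial if it has a cordial labeling. The Möbius ladder $M_k$ consists of the cycle $C_{2k}$ together with $k$ additional edges joining the opposite pairs of vertices of the cycle. -}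

module Defs where

open import Data.Empty using (⊥)
open import Data.Fin using (Fin; zero; suc; toℕ; _↑ˡ_; _↑ʳ_; splitAt)
open import Data.Fin.Properties using (_≟_; nonZeroIndex; toℕ<n; toℕ-fromℕ<; toℕ-↑ˡ; toℕ-↑ʳ)
open import Data.Nat using (ℕ; zero; suc; _+_; _≤_; _<_; ∣_-_∣; NonZero)
open import Data.Nat.DivMod using (_%_; _mod_; m%n<n; m<n⇒m%n≡m; n%n≡0)
open import Data.Nat.Properties using (m≤n⇒m<n∨m≡n; 1+n≢n; <⇒≢; ≤-trans; m≤m+n; +-suc)
open import Data.Product using (Σ; _×_; _,_; proj₁; proj₂)
open import Data.Sum using (_⊎_; inj₁; inj₂; [_,_]′)
open import Data.Vec using (allFin; count)
open import Relation.Binary.PropositionalEquality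

-- Multiple edges are allowed. Each edge lists its two ends in an arbitrary
-- order; nothing below depends on that order.
record Graph : Set where
  field
    order    : ℕ
    size     : ℕ
    ends     : Fin size → Fin order × Fin order
    loopless : ∀ e → proj₁ (ends e) ≢ proj₂ (ends e)

  V E : Set
  V = Fin order
  E = Fin size

open Graph using (V; E)

-- Only cardinalities are ever compared, so ℕ suffices in place of the reals.
RoughlyEqual : ℕ → ℕ → Set
RoughlyEqual x y = ∣ x - y ∣ ≤ 1

∣_⁻¹_∣ : ∀ {n} → (Fin n → Fin 2) → Fin 2 → ℕ
∣_⁻¹_∣ {n} f b = count (λ x → f x ≟ b) (allFin n)

Balanced : ∀ {n} → (Fin n → Fin 2) → Set
Balanced f = RoughlyEqual ∣ f ⁻¹ zero ∣ ∣ f ⁻¹ suc zero ∣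

BinaryLabeling : Graph → Set
BinaryLabeling G = V G → Fin 2

edgeLabeling : (G : Graph) → BinaryLabeling G → E G → Fin 2
edgeLabeling G f e = let (u , v) = Graph.ends G e in (toℕ (f u) + toℕ (f v)) mod 2

Friendly : (G : Graph) → BinaryLabeling G → Set
Friendly G f = Balanced f

CordialLabeling : (G : Graph) → BinaryLabeling G → Set
CordialLabeling G f = Friendly G f × Balanced (edgeLabeling G f)

Cordial : Graph → Set
Cordial G = Σ (BinaryLabeling G) (CordialLabeling G)

next : ∀ {n} → Fin n → Fin n
next {n} i = _mod_ (suc (toℕ i)) n {{nonZeroIndex i}}

next-≢ : ∀ {n} → n ≢ 1 → (i : Fin n) → i ≢ next i
next-≢ {n} n≢1 i i≡next = helper (m≤n⇒m<n∨m≡n (toℕ<n i))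
  where
  instance
    n≢0 : NonZero n
    n≢0 = nonZeroIndex i

  i≡ : toℕ i ≡ suc (toℕ i) % n
  i≡ = trans (cong toℕ i≡next) (toℕ-fromℕ< (m%n<n (suc (toℕ i)) n))

  helper : suc (toℕ i) < n ⊎ suc (toℕ i) ≡ n → ⊥
  helper (inj₁ lt) = 1+n≢n (sym (trans i≡ (m<n⇒m%n≡m lt)))
  helper (inj₂ eq) = n≢1 (trans (sym eq) (cong suc
    (trans i≡ (trans (cong (_% n) eq) (n%n≡0 n)))))

k+k≢1 : ∀ k → k + k ≢ 1
k+k≢1 (suc k) eq with trans (sym (+-suc (suc k) k)) eq
... | ()

↑ˡ≢↑ʳ : ∀ {k} (i : Fin k) → i ↑ˡ k ≢ k ↑ʳ i
↑ˡ≢↑ʳ {k} i eq = <⇒≢ (≤-trans (toℕ<n i) (m≤m+n k (toℕ i)))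
  (trans (sym (toℕ-↑ˡ i k)) (trans (cong toℕ eq) (toℕ-↑ʳ k i)))

cycleEnds : ∀ {n} → Fin n → Fin n × Fin n
cycleEnds i = i , next i

-- The rung i joins the vertices i and k + i.
rungEnds : ∀ {k} → Fin k → Fin (k + k) × Fin (k + k)
rungEnds {k} i = i ↑ˡ k , k ↑ʳ i

-- The first k + k edges form the cycle and the last k are the rungs.
möbiusLadder : ℕ → Graph
möbiusLadder k = record
  { order    = k + k
  ; size     = (k + k) + k
  ; ends     = λ e → [ cycleEnds , rungEnds ]′ (splitAt (k + k) e)
  ; loopless = λ e → noLoop (splitAt (k + k) e)
  }
  where
  noLoop : (s : Fin (k + k) ⊎ Fin k) →
           proj₁ ([ cycleEnds , rungEnds ]′ s) ≢ proj₂ ([ cycleEnds , rungEnds ]′ s)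
  noLoop (inj₁ i) = next-≢ (k+k≢1 k) i
  noLoop (inj₂ i) = ↑ˡ≢↑ʳ i

{-# OPTIONS --safe #-}
-- Write the vertices i and k + i of the ladder as a column (aᵢ, bᵢ). Going once
-- through the k columns, the cycle closes with a twist: column k must be column
-- 0 with its two entries exchanged. The period of columns 00 01 11 10 (in any
-- rotation) adds 4 ones among 8 vertices and 6 ones among 12 edges, so it
-- preserves cordiality. It remains to find a suitable prefix of length 0, 5 and
-- 3, for k ≡ 0, 1 and 3 modulo 4.
module Submission where

open import Defs
open import Algebra.Properties.CommutativeSemigroup using (interchange)
open import Data.Bool using (true; false; if_then_else_)
open import Data.Empty using (⊥-elim)
open import Data.Fin using (Fin; zero; suc; toℕ; _↑ˡ_; _↑ʳ_; splitAt)
open import Data.Fin.Properties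
  using (_≟_; nonZeroIndex; toℕ<n; toℕ-fromℕ<; toℕ-↑ˡ; toℕ-↑ʳ; splitAt⁻¹-↑ˡ; splitAt⁻¹-↑ʳ)
open import Data.List using (List; []; _∷_)
open import Data.Nat
  using (ℕ; zero; suc; _+_; _*_; _≤_; _<_; _≥_; z≤n; s≤s; ∣_-_∣; NonZero)
open import Data.Nat.DivMod
  using (_%_; _/_; _mod_; m%n<n; m<n⇒m%n≡m; n%n≡0; m≡m%n+[m/n]*n)
open import Data.Nat.Properties
  using (+-assoc; +-comm; +-suc; *-distribˡ-+; m≤n⇒m<n∨m≡n; ∣m+n-m+o∣≡∣n-o∣;
         +-commutativeSemigroup)
open import Data.Product using (_,_)
open import Data.Sum using (_⊎_; inj₁; inj₂)
open import Data.Vec using (count; tabulate)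
open import Function using (_∘_; id)
open import Relation.Binary.PropositionalEquality
open import Relation.Nullary using (does)

open ≡-Reasoning

-- Binary sequences and counting their values

Bits : Set
Bits = ℕ → Fin 2

infixl 6 _⊕_
_⊕_ : Fin 2 → Fin 2 → Fin 2
x ⊕ y = (toℕ x + toℕ y) mod 2

steps : Bits → Bits
steps s i = s i ⊕ s (suc i)

rungs : Bits → Bits → Bits
rungs a b i = a i ⊕ b i

indicator : Fin 2 → Fin 2 → ℕ
indicator v x = if does (x ≟ v) then 1 else 0

occurrences : Fin 2 → ℕ → Bits → ℕ
occurrences v zero    s = 0
occurrences v (suc n) s = indicator v (s 0) + occurrences v n (s ∘ suc)

occurrences-cong : ∀ v n {s t : Bits} → (∀ i → i < n → s i ≡ t i) →
                   occurrences v n s ≡ occurrences v n t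
occurrences-cong v zero    eq = refl
occurrences-cong v (suc n) eq =
  cong₂ _+_ (cong (indicator v) (eq 0 (s≤s z≤n)))
            (occurrences-cong v n (λ i i<n → eq (suc i) (s≤s i<n)))

occurrences-+ : ∀ v m n s →
                occurrences v (m + n) s ≡ occurrences v m s + occurrences v n (s ∘ (m +_))
occurrences-+ v zero    n s = refl
occurrences-+ v (suc m) n s =
  trans (cong (indicator v (s 0) +_) (occurrences-+ v m n (s ∘ suc)))
        (sym (+-assoc (indicator v (s 0)) _ _))

occurrences-periodic : ∀ v m p s → (∀ i → s (p + i) ≡ s i) →
                       occurrences v (m * p) s ≡ m * occurrences v p s
occurrences-periodic v zero    p s per = refl
occurrences-periodic v (suc m) p s per = begin
  occurrences v (p + m * p) s
    ≡⟨ occurrences-+ v p (m * p) s ⟩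
  occurrences v p s + occurrences v (m * p) (s ∘ (p +_))
    ≡⟨ cong (occurrences v p s +_) (occurrences-cong v (m * p) (λ i _ → per i)) ⟩
  occurrences v p s + occurrences v (m * p) s
    ≡⟨ cong (occurrences v p s +_) (occurrences-periodic v m p s per) ⟩
  occurrences v p s + m * occurrences v p s ∎

-- The enumeration `g` is arbitrary because the tail of `allFin` is a tabulation of `suc`, not of
-- `id`; the induction passes from `g` to `g ∘ suc`.
count-tabulate : ∀ {A : Set} v n (f : A → Fin 2) (g : Fin n → A) s →
                 (∀ i → f (g i) ≡ s (toℕ i)) →
                 count (λ x → f x ≟ v) (tabulate g) ≡ occurrences v n s
count-tabulate v zero    f g s eq = refl
count-tabulate v (suc n) f g s eq
  rewrite sym (eq zero) | sym (count-tabulate v n f (g ∘ suc) (s ∘ suc) (eq ∘ suc))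
  with does (f (g zero) ≟ v)
... | true  = refl
... | false = refl

∣⁻¹∣≡occurrences : ∀ {n} (f : Fin n → Fin 2) s → (∀ i → f i ≡ s (toℕ i)) →
                   ∀ v → ∣ f ⁻¹ v ∣ ≡ occurrences v n s
∣⁻¹∣≡occurrences {n} f s eq v = count-tabulate v n f id s eq

-- Concatenation of sequences and closing up a cycle

glue : ℕ → Bits → Bits → Bits
glue zero    a b i       = b i
glue (suc k) a b zero    = a 0
glue (suc k) a b (suc i) = glue k (a ∘ suc) b i

glue-< : ∀ k {a b i} → i < k → glue k a b i ≡ a i
glue-< (suc k) {i = zero}  _         = refl
glue-< (suc k) {i = suc i} (s≤s i<k) = glue-< k i<k

glue-+ : ∀ k {a b} i → glue k a b (k + i) ≡ b i
glue-+ zero    i = refl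
glue-+ (suc k) i = glue-+ k i

-- Position `k` already belongs to `b`, but the agreement `a k ≡ b 0` lets it be read from `a`. The
-- step leaving position `k - 1` needs this extra place.
glue-≤ : ∀ k {a b i} → a k ≡ b 0 → i ≤ k → glue k a b i ≡ a i
glue-≤ zero    eq z≤n       = sym eq
glue-≤ (suc k) eq z≤n       = refl
glue-≤ (suc k) eq (s≤s i≤k) = glue-≤ k eq i≤k

occurrences-glue : ∀ v m n a b →
                   occurrences v (m + n) (glue m a b) ≡ occurrences v m a + occurrences v n b
occurrences-glue v m n a b =
  trans (occurrences-+ v m n (glue m a b))
        (cong₂ _+_ (occurrences-cong v m (λ _ → glue-< m))
                   (occurrences-cong v n (λ i _ → glue-+ m i)))

-- Reduction modulo `n` matters only at the last vertex, where closedness replaces `s 0` by `s n`.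
-- Labels of cycle edges thereby become `steps s`, free of modular arithmetic.
next-closed : ∀ {n} (s : Bits) → s n ≡ s 0 → (i : Fin n) →
              s (toℕ (next i)) ≡ s (suc (toℕ i))
next-closed {n} s closed i =
  trans (cong s (toℕ-fromℕ< (m%n<n (suc (toℕ i)) n))) (helper (m≤n⇒m<n∨m≡n (toℕ<n i)))
  where
  instance
    n≢0 : NonZero n
    n≢0 = nonZeroIndex i

  helper : suc (toℕ i) < n ⊎ suc (toℕ i) ≡ n → s (suc (toℕ i) % n) ≡ s (suc (toℕ i))
  helper (inj₁ lt) = cong s (m<n⇒m%n≡m lt)
  helper (inj₂ eq) = begin
    s (suc (toℕ i) % n) ≡⟨ cong (λ j → s (j % n)) eq ⟩
    s (n % n)           ≡⟨ cong s (n%n≡0 n) ⟩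
    s 0                 ≡⟨ closed ⟨
    s n                 ≡⟨ cong s eq ⟨
    s (suc (toℕ i))     ∎

-- Labelings of the ladder given by two rows

vertexCount : Fin 2 → ℕ → Bits → Bits → ℕ
vertexCount v k a b = occurrences v k a + occurrences v k b

edgeCount : Fin 2 → ℕ → Bits → Bits → ℕ
edgeCount v k a b =
  occurrences v k (steps a) + occurrences v k (steps b) + occurrences v k (rungs a b)

module _ (k : ℕ) (a b : Bits) (aₖ≡b₀ : a k ≡ b 0) (bₖ≡a₀ : b k ≡ a 0) where

  private
    s : Bits
    s = glue k a b

    -- The twist has two halves: `aₖ≡b₀` joins the first row to the second, and `bₖ≡a₀` returns from
    -- the second row to the start of the cycle.
    s-closed : s (k + k) ≡ s 0
    s-closed = trans (glue-+ k k) (trans bₖ≡a₀ (sym (glue-≤ k aₖ≡b₀ z≤n)))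

    s-left : (i : Fin k) → s (toℕ (i ↑ˡ k)) ≡ a (toℕ i)
    s-left i = trans (cong s (toℕ-↑ˡ i k)) (glue-< k (toℕ<n i))

    s-right : (i : Fin k) → s (toℕ (k ↑ʳ i)) ≡ b (toℕ i)
    s-right i = trans (cong s (toℕ-↑ʳ k i)) (glue-+ k (toℕ i))

    steps-left : ∀ i → i < k → steps s i ≡ steps a i
    steps-left i i<k = cong₂ _⊕_ (glue-< k i<k) (glue-≤ k aₖ≡b₀ i<k)

    steps-right : ∀ i → steps s (k + i) ≡ steps b i
    steps-right i =
      cong₂ _⊕_ (glue-+ k i) (trans (cong s (sym (+-suc k i))) (glue-+ k (suc i)))

    -- The order follows the edge list of `möbiusLadder`: the cycle first, then the rungs.
    edges : Bits
    edges = glue (k + k) (steps s) (rungs a b)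

  columnLabeling : BinaryLabeling (möbiusLadder k)
  columnLabeling = s ∘ toℕ

  vertices-columnLabeling : ∀ v → ∣ columnLabeling ⁻¹ v ∣ ≡ vertexCount v k a b
  vertices-columnLabeling v =
    trans (∣⁻¹∣≡occurrences columnLabeling s (λ _ → refl) v) (occurrences-glue v k k a b)

  edgeLabeling-columnLabeling : ∀ e →
    edgeLabeling (möbiusLadder k) columnLabeling e ≡ edges (toℕ e)
  edgeLabeling-columnLabeling e with splitAt (k + k) e in eq
  ... | inj₁ i = begin
    s (toℕ i) ⊕ s (toℕ (next i)) ≡⟨ cong (s (toℕ i) ⊕_) (next-closed s s-closed i) ⟩
    steps s (toℕ i)              ≡⟨ glue-< (k + k) (toℕ<n i) ⟨
    edges (toℕ i)                ≡⟨ cong edges (toℕ-↑ˡ i k) ⟨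
    edges (toℕ (i ↑ˡ k))         ≡⟨ cong (edges ∘ toℕ) (splitAt⁻¹-↑ˡ eq) ⟩
    edges (toℕ e)                ∎
  ... | inj₂ i = begin
    s (toℕ (i ↑ˡ k)) ⊕ s (toℕ (k ↑ʳ i)) ≡⟨ cong₂ _⊕_ (s-left i) (s-right i) ⟩
    rungs a b (toℕ i)                   ≡⟨ glue-+ (k + k) (toℕ i) ⟨
    edges (k + k + toℕ i)               ≡⟨ cong edges (toℕ-↑ʳ (k + k) i) ⟨
    edges (toℕ ((k + k) ↑ʳ i))          ≡⟨ cong (edges ∘ toℕ) (splitAt⁻¹-↑ʳ eq) ⟩
    edges (toℕ e)                       ∎

  edges-columnLabeling : ∀ v →
    ∣ edgeLabeling (möbiusLadder k) columnLabeling ⁻¹ v ∣ ≡ edgeCount v k a b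
  edges-columnLabeling v = begin
    ∣ edgeLabeling (möbiusLadder k) columnLabeling ⁻¹ v ∣
      ≡⟨ ∣⁻¹∣≡occurrences _ edges edgeLabeling-columnLabeling v ⟩
    occurrences v (k + k + k) edges
      ≡⟨ occurrences-glue v (k + k) k (steps s) (rungs a b) ⟩
    occurrences v (k + k) (steps s) + occurrences v k (rungs a b)
      ≡⟨ cong (_+ occurrences v k (rungs a b)) (occurrences-+ v k k (steps s)) ⟩
    occurrences v k (steps s) + occurrences v k (steps s ∘ (k +_)) + occurrences v k (rungs a b)
      ≡⟨ cong₂ (λ x y → x + y + occurrences v k (rungs a b))
           (occurrences-cong v k steps-left)
           (occurrences-cong v k (λ i _ → steps-right i)) ⟩
    edgeCount v k a b ∎

  columns-cordial : RoughlyEqual (vertexCount zero k a b) (vertexCount (suc zero) k a b) →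
                    RoughlyEqual (edgeCount zero k a b) (edgeCount (suc zero) k a b) →
                    Cordial (möbiusLadder k)
  columns-cordial vertices≈ edges≈ = columnLabeling ,
    subst₂ RoughlyEqual (sym (vertices-columnLabeling _)) (sym (vertices-columnLabeling _)) vertices≈ ,
    subst₂ RoughlyEqual (sym (edges-columnLabeling _)) (sym (edges-columnLabeling _)) edges≈

-- Repeating a period after a prefix

roughlyEqual-+ʳ : ∀ {x y} z → RoughlyEqual x y → RoughlyEqual (x + z) (y + z)
roughlyEqual-+ʳ {x} {y} z =
  subst (_≤ 1) (sym (trans (cong₂ ∣_-_∣ (+-comm x z) (+-comm y z)) (∣m+n-m+o∣≡∣n-o∣ z x y)))

+-*-interchange : ∀ m w x y z → (w + m * x) + (y + m * z) ≡ (w + y) + m * (x + z)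
+-*-interchange m w x y z =
  trans (interchange +-commutativeSemigroup w (m * x) y (m * z))
        (cong ((w + y) +_) (sym (*-distribˡ-+ m x z)))

-- A record rather than a function type, so that s can be inferred.
record PeriodicAfter (c p : ℕ) (s : Bits) : Set where
  constructor periodic
  field shift : ∀ i → s (c + (p + i)) ≡ s (c + i)

open PeriodicAfter

module _ {c p : ℕ} where

  periodicAfter-* : ∀ {s} → PeriodicAfter c p s → ∀ m → s (c + m * p) ≡ s (c + 0)
  periodicAfter-* per zero    = refl
  periodicAfter-* per (suc m) = trans (shift per (m * p)) (periodicAfter-* per m)

  rungs-periodicAfter : ∀ {s t} → PeriodicAfter c p s → PeriodicAfter c p t →
                        PeriodicAfter c p (rungs s t)
  rungs-periodicAfter per-s per-t .shift i = cong₂ _⊕_ (shift per-s i) (shift per-t i)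

  steps-periodicAfter : ∀ {s} → PeriodicAfter c p s → PeriodicAfter c p (steps s)
  -- `steps s` unfolds to `rungs s (s ∘ suc)`, so it suffices that `s ∘ suc` is periodic as well.
  steps-periodicAfter {s} per = rungs-periodicAfter per (periodic shift-suc)
    where
    shift-suc : ∀ i → s (suc (c + (p + i))) ≡ s (suc (c + i))
    shift-suc i = begin
      s (suc (c + (p + i))) ≡⟨ cong s (trans (cong (c +_) (+-suc p i)) (+-suc c (p + i))) ⟨
      s (c + (p + suc i))   ≡⟨ shift per (suc i) ⟩
      s (c + suc i)         ≡⟨ cong s (+-suc c i) ⟩
      s (suc (c + i))       ∎

  occurrences-periodicAfter : ∀ {s} → PeriodicAfter c p s → ∀ v m →
    occurrences v (c + m * p) s ≡ occurrences v c s + m * occurrences v p (s ∘ (c +_))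
  occurrences-periodicAfter {s} per v m =
    trans (occurrences-+ v c (m * p) s)
          (cong (occurrences v c s +_) (occurrences-periodic v m p (s ∘ (c +_)) (shift per)))

  module _ {a b : Bits} (per-a : PeriodicAfter c p a) (per-b : PeriodicAfter c p b) where

    vertexPeriod edgePeriod : Fin 2 → ℕ
    vertexPeriod v = occurrences v p (a ∘ (c +_)) + occurrences v p (b ∘ (c +_))
    edgePeriod v = occurrences v p (steps a ∘ (c +_)) + occurrences v p (steps b ∘ (c +_))
                   + occurrences v p (rungs a b ∘ (c +_))

    vertexCount-periodicAfter : ∀ v m →
      vertexCount v (c + m * p) a b ≡ vertexCount v c a b + m * vertexPeriod v
    vertexCount-periodicAfter v m =
      trans (cong₂ _+_ (occurrences-periodicAfter per-a v m) (occurrences-periodicAfter per-b v m))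
            (+-*-interchange m (occurrences v c a) _ _ _)

    edgeCount-periodicAfter : ∀ v m →
      edgeCount v (c + m * p) a b ≡ edgeCount v c a b + m * edgePeriod v
    edgeCount-periodicAfter v m = trans
      (cong₂ _+_
        (trans (cong₂ _+_ (occurrences-periodicAfter (steps-periodicAfter per-a) v m)
                          (occurrences-periodicAfter (steps-periodicAfter per-b) v m))
               (+-*-interchange m (occurrences v c (steps a)) _ _ _))
        (occurrences-periodicAfter (rungs-periodicAfter per-a per-b) v m))
      (+-*-interchange m (occurrences v c (steps a) + occurrences v c (steps b)) _ _ _)

    -- A period with as many zeros as ones, among vertices and among edges, leaves both differences
    -- as they are in the prefix. The twisted closing is also checked on the prefix alone: by
    -- periodicity, column `c + m * p` equals column `c`.
    periodicColumns-cordial :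
      a (c + 0) ≡ b 0 → b (c + 0) ≡ a 0 →
      RoughlyEqual (vertexCount zero c a b) (vertexCount (suc zero) c a b) →
      RoughlyEqual (edgeCount zero c a b) (edgeCount (suc zero) c a b) →
      vertexPeriod zero ≡ vertexPeriod (suc zero) →
      edgePeriod zero ≡ edgePeriod (suc zero) →
      ∀ m → Cordial (möbiusLadder (c + m * p))
    periodicColumns-cordial a≡b₀ b≡a₀ vertices≈ edges≈ vertices≡ edges≡ m =
      columns-cordial (c + m * p) a b
        (trans (periodicAfter-* per-a m) a≡b₀)
        (trans (periodicAfter-* per-b m) b≡a₀)
        (extend (λ v → vertexCount-periodicAfter v m) vertices≈ vertices≡)
        (extend (λ v → edgeCount-periodicAfter v m) edges≈ edges≡)
      where
      extend : {total prefix period : Fin 2 → ℕ} →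
               (∀ v → total v ≡ prefix v + m * period v) →
               RoughlyEqual (prefix zero) (prefix (suc zero)) →
               period zero ≡ period (suc zero) →
               RoughlyEqual (total zero) (total (suc zero))
      extend {prefix = prefix} {period} total≡ prefix≈ period≡ =
        subst₂ RoughlyEqual
          (sym (total≡ zero))
          (sym (trans (total≡ (suc zero))
                      (cong (λ x → prefix (suc zero) + m * x) (sym period≡))))
          (roughlyEqual-+ʳ {prefix zero} (m * period zero) prefix≈)

-- Explicit columns for each residue modulo 4

pattern 𝟎 = zero
pattern 𝟏 = suc zero

cycle₄ : Fin 2 → Fin 2 → Fin 2 → Fin 2 → Bits
cycle₄ w x y z 0                         = w
cycle₄ w x y z 1                         = x
cycle₄ w x y z 2                         = y
cycle₄ w x y z 3                         = z
cycle₄ w x y z (suc (suc (suc (suc i)))) = cycle₄ w x y z i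

infixr 5 _⁺⁺_
_⁺⁺_ : List (Fin 2) → Bits → Bits
([] ⁺⁺ s) i             = s i
((x ∷ xs) ⁺⁺ s) zero    = x
((x ∷ xs) ⁺⁺ s) (suc i) = (xs ⁺⁺ s) i

cordial-0+4m : ∀ m → Cordial (möbiusLadder (m * 4))
-- Column 0 is 00, which the exchange fixes, so the period closes up without a prefix. All
-- conditions concern concrete columns and hold by computation.
cordial-0+4m = periodicColumns-cordial {0} {4} {cycle₄ 𝟎 𝟎 𝟏 𝟏} {cycle₄ 𝟎 𝟏 𝟏 𝟎}
  (periodic λ _ → refl) (periodic λ _ → refl) refl refl z≤n z≤n refl refl

-- A prefix of length 1 cannot work: its three edges all join the same two vertices, so a friendly
-- labeling gives them all label 1. The prefix 01 01 00 10 11 has 5 ones among 10 vertices and 7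
-- among 15 edges; the period then starts at 10, the exchange of column 0.
cordial-5+4m : ∀ m → Cordial (möbiusLadder (5 + m * 4))
cordial-5+4m = periodicColumns-cordial {5} {4}
  {(𝟎 ∷ 𝟎 ∷ 𝟎 ∷ 𝟏 ∷ 𝟏 ∷ []) ⁺⁺ cycle₄ 𝟏 𝟎 𝟎 𝟏}
  {(𝟏 ∷ 𝟏 ∷ 𝟎 ∷ 𝟎 ∷ 𝟏 ∷ []) ⁺⁺ cycle₄ 𝟎 𝟎 𝟏 𝟏}
  (periodic λ _ → refl) (periodic λ _ → refl) refl refl z≤n (s≤s z≤n) refl refl

-- The prefix 00 01 11 has 3 ones among 6 vertices and 5 among 9 edges, and is followed by 00, which
-- is column 0 and its own exchange.
cordial-3+4m : ∀ m → Cordial (möbiusLadder (3 + m * 4))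
cordial-3+4m = periodicColumns-cordial {3} {4}
  {(𝟎 ∷ 𝟎 ∷ 𝟏 ∷ []) ⁺⁺ cycle₄ 𝟎 𝟎 𝟏 𝟏}
  {(𝟎 ∷ 𝟏 ∷ 𝟏 ∷ []) ⁺⁺ cycle₄ 𝟎 𝟏 𝟏 𝟎}
  (periodic λ _ → refl) (periodic λ _ → refl) refl refl z≤n (s≤s z≤n) refl refl

theorem4 : (k : ℕ) → k % 4 ≢ 2 → k ≥ 3 → Cordial (möbiusLadder k)
theorem4 k k%4≢2 k≥3 = helper (k % 4) (k / 4) (m%n<n k 4) k%4≢2 (m≡m%n+[m/n]*n k 4) k≥3
  where
  -- Remainder and quotient are made independent variables, so that matching on `refl` can replace
  -- `k` by `r + q * 4`.
  helper : ∀ r q {k} → r < 4 → r ≢ 2 → k ≡ r + q * 4 → k ≥ 3 → Cordial (möbiusLadder k)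
  helper 0 q       _ _   refl _        = cordial-0+4m q
  helper 1 zero    _ _   refl (s≤s ())
  -- One period is absorbed into the prefix: `1 + suc q * 4` computes to `5 + q * 4`.
  helper 1 (suc q) _ _   refl _        = cordial-5+4m q
  helper 2 q       _ r≢2 _    _        = ⊥-elim (r≢2 refl)
  helper 3 q       _ _   refl _        = cordial-3+4m q
  helper (suc (suc (suc (suc r)))) q (s≤s (s≤s (s≤s (s≤s ())))) _ _ _
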